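{- Let $e,f,g\in StExp(A)$ with $f{\not\downarrow}$, and let $\Gamma:=\{\,e=f\cdot e+g\,\}$. Then $e\overset{\mathrm{LLEE}}{=}_{\mathsf{Mil}^-+\Gamma}f^*\cdot g$, that is, there is a LLEE-witnessed coinductive proof over $\mathsf{Mil}^-+\Gamma$ of the equation $e=f^*\cdot g$.
   Context: **Star expressions.** For a set $A$ of actions, the set $StExp(A)$ of star expressions is generated by $e ::= 0\mid 1\mid a\mid (e_1+e_2)\mid (e_1\cdot e_2)\mid e^*$ with $a\in A$. $\sum_{i=1}^n e_i$ is $0$ for $n=0$, $e_1$ for $n=1$, and $(\sum_{i=1}^{n-1}e_i)+e_n$ for $n>1$. $Eq(A)$ is the set of formal equations $e=f$ with $e,f\in StExp(A)$. Immediate termination $e{\downarrow}$ is defined inductively by: $1{\downarrow}$; $(e_1+e_2){\downarrow}$ if $e_1{\downarrow}$ or $e_2{\downarrow}$; $(e_1\cdot e_2){\downarrow}$ if $e_1{\downarrow}$ and $e_2{\downarrow}$; $(e^*){\downarrow}$ always. Write $e{\not\downarrow}$ if $e{\downarrow}$ does not hold. **Proof systems.** An $Eq(A)$-based proof system is a Hilbert-style proof system whose formulas are the equations in $Eq(A)$; $e=_S f$ means that $e=f$ is derivable in $S$ without assumptions. It is $\mathcal{EL}$-based if its rules include those of equational logic: reflexivity, symmetry, transitivity, and the context rule (from $e=f$ infer $C[e]=C[f]$ for one-hole star expression contexts $C$). $S+\Gamma$ adds the equations in $\Gamma\subseteq Eq(A)$ as axioms to $S$. $\mathsf{ACI}$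 consists of the axioms $(e+f)+g=e+(f+g)$, $e+f=f+e$, $e+e=e$; $\mathsf{ACI}\sqsubseteq S$ means that all of these are axioms of $S$. $\mathsf{Mil}^-$ is the $\mathcal{EL}$-based system with exactly the rules of equational logic and the axiom schemes: $(e+f)+g=e+(f+g)$, $e+0=e$, $e+f=f+e$, $e+e=e$, $(e\cdot f)\cdot g=e\cdot(f\cdot g)$, $(e+f)\cdot g=e\cdot g+f\cdot g$, $1\cdot e=e$, $e\cdot 1=e$, $0\cdot e=0$, $e^*=1+e\cdot e^*$, $e^*=(1+e)^*$. **1-charts and solutions.** A 1-chart is $C=\langle V,A,1,v_s,\to,\downarrow\rangle$ with a finite set $V$ of vertices, a set $A$ of (proper) action labels, an empty-step label $1\notin A$, a start vertex $v_s\in V$, a transition relation $\to\,\subseteq V\times(A\cup\{1\})\times V$, and a set $\downarrow\,\subseteq V$ of vertices with immediate termination. Transitions with label in $A$ are proper; those with label $1$ are 1-transitions. $C$ is weakly guarded if it has no cycle of 1-transitions. For an $\mathcal{EL}$-based system $S$ with $\mathsf{ACI}\sqsubseteq S$, a function $s:V\to StExp(A)$ is an $S$-provable solution of $C$ if for every $v\in V$: $s(v)=_S\tau_C(v)+\sum_{i=1}^n\underline a_i\cdot s(v_i)$, where $v\xrightarrow{\underline a_i}v_i$ ($1\le i\le n$, $\underline a_i\in A\cup\{1\}$) is a (possibly redundant) list of all transitions from $v$, and $\tau_C(v)$ is $1$ if $v{\downarrow}$ and $0$ otherwise. **Guarded LLEE-1-charts.** A loop 1-chart is a 1-chart such that (L1)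 there is an infinite path from the start vertex, (L2) every infinite path from the start vertex returns to it after a positive number of transitions, (L3) immediate termination is only permitted at the start vertex. Its transitions from the start vertex are its loop-entry transitions, all other transitions belong to its body. A loop sub-1-chart of $C$ is a loop 1-chart $L$ that is a sub-1-chart of $C$ with some vertex $v$ of $C$ as start vertex, formed, for a nonempty set $U$ of transitions of $C$ from $v$ (the loop-entry transitions of $L$), by all vertices and transitions on paths that start with a transition in $U$ and continue onward until $v$ is reached again. A multi-step loop elimination of loop sub-1-charts $L_1,\dots,L_n$ ($n\ge1$) from $C$, where their sets of loop-entry transitions are pairwise disjoint and no start vertex of one is in the body of another one, removes all loop-entry transitions of $L_1,\dots,L_n$, and then all vertices and transitions that become unreachable. A run (sequence of multi-steps) from $C$ is successful if it leads to a 1-chart without an infinite path; it is layered if it never removes loop-entry transitions that depart from a vertex in the body of a previously eliminated loop sub-1-chart. A LLEE-witness of $C$ is the labeling of the transitions of $C$ by natural numbers that records a successful layered run: marking label $n\ge1$ for transitions removed as loop-entry transitions in the $n$-th multi-step ('loop-entry transitions'), label $0$ for all other transitions ('body transitions'). It is guarded if all of its loop-entry transitions are proper. A guarded LLEE-1-chart is a 1-chart that has a guarded LLEE-witness. **Coinductive proofs.** Let $S$ be $\mathcal{EL}$-based with $\mathsf{ACI}\sqsubseteq S$ (soundness of $S$ is not required). A coinductive proof over $S$ of $e_1=e_2$ is a pair $\langle C,L\rangle$ of a weakly guarded 1-chart $C$ with start vertex $v_s$ and a function $L:V(C)\to Eq(A)$, $v\mapsto (L_1(v)=L_2(v))$,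 such that $L_1$ and $L_2$ are $S$-provable solutions of $C$ and $L_1(v_s)\equiv e_1$, $L_2(v_s)\equiv e_2$ (syntactic equality). It is LLEE-witnessed if $C$ is a guarded LLEE-1-chart. $e_1\overset{\mathrm{LLEE}}{=}_S e_2$ means that there is a LLEE-witnessed coinductive proof over $S$ of $e_1=e_2$. -}

module Defs where

open import Data.Bool using (Bool; T; if_then_else_)
open import Data.Empty using (⊥)
open import Data.Fin using (Fin)
open import Data.List using (List; []; _∷_; foldl; map)
open import Data.List.Membership.Propositional using (_∈_)
open import Data.Nat using (ℕ; zero; suc; _≥_)
open import Data.Product using (Σ; ∃; ∃-syntax; _×_; _,_; proj₁; proj₂)
open import Data.Sum using (_⊎_; inj₁; inj₂)
open import Data.Unit using (⊤)
open import Function using (_∘_; _↔_; _⇔_)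
open import Level using (0ℓ)
open import Relation.Binary.Construct.Closure.ReflexiveTransitive
  using (Star; ε; _◅_; _◅◅_)
open import Relation.Binary.Construct.Closure.Transitive using (TransClosure)
open import Relation.Binary.PropositionalEquality using (_≡_; _≢_; refl)
open import Relation.Nullary using (¬_)
open import Relation.Unary using (Pred; _⊆_; _∪_)

infixl 6 _+_
infixl 7 _·_
infix  8 _⋆
infix  4 _≐_ _↓

data StExp (A : Set) : Set where
  𝟘 𝟙 : StExp A
  `_  : A → StExp A
  _+_ : StExp A → StExp A → StExp A
  _·_ : StExp A → StExp A → StExp A
  _⋆  : StExp A → StExp A

-- Brackets to the left: ∑ (e₁ ∷ e₂ ∷ e₃ ∷ []) is (e₁ + e₂) + e₃, without
-- an initial summand 𝟘.
∑ : {A : Set} → List (StExp A) → StExp A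
∑ []       = 𝟘
∑ (e ∷ es) = foldl _+_ e es

record Eq (A : Set) : Set where
  constructor _≐_
  field
    lhs rhs : StExp A
open Eq public

data _↓ {A : Set} : StExp A → Set where
  𝟙↓  : 𝟙 ↓
  +↓ˡ : ∀ {e f} → e ↓ → e + f ↓
  +↓ʳ : ∀ {e f} → f ↓ → e + f ↓
  ·↓  : ∀ {e f} → e ↓ → f ↓ → e · f ↓
  ⋆↓  : ∀ {e} → e ⋆ ↓

------------------------------------------------------------------------
-- Proof systems

data Context (A : Set) : Set where
  □    : Context A
  _+ˡ_ : Context A → StExp A → Context A
  _+ʳ_ : StExp A → Context A → Context A
  _·ˡ_ : Context A → StExp A → Context A
  _·ʳ_ : StExp A → Context A → Context A
  _⋆ᶜ  : Context A → Context A

_[_] : {A : Set} → Context A → StExp A → StExp A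
□        [ e ] = e
(C +ˡ f) [ e ] = C [ e ] + f
(f +ʳ C) [ e ] = f + C [ e ]
(C ·ˡ f) [ e ] = C [ e ] · f
(f ·ʳ C) [ e ] = f · C [ e ]
(C ⋆ᶜ)   [ e ] = (C [ e ]) ⋆

data ACI {A : Set} : Pred (Eq A) 0ℓ where
  +-assoc : ∀ e f g → ACI ((e + f) + g ≐ e + (f + g))
  +-comm  : ∀ e f   → ACI (e + f ≐ f + e)
  +-idem  : ∀ e     → ACI (e + e ≐ e)

data Mil⁻-Axiom {A : Set} : Pred (Eq A) 0ℓ where
  +-assoc   : ∀ e f g → Mil⁻-Axiom ((e + f) + g ≐ e + (f + g))
  +-neutral : ∀ e     → Mil⁻-Axiom (e + 𝟘 ≐ e)
  +-comm    : ∀ e f   → Mil⁻-Axiom (e + f ≐ f + e)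
  +-idem    : ∀ e     → Mil⁻-Axiom (e + e ≐ e)
  ·-assoc   : ∀ e f g → Mil⁻-Axiom ((e · f) · g ≐ e · (f · g))
  ·-distʳ-+ : ∀ e f g → Mil⁻-Axiom ((e + f) · g ≐ e · g + f · g)
  ·-idˡ     : ∀ e     → Mil⁻-Axiom (𝟙 · e ≐ e)
  ·-idʳ     : ∀ e     → Mil⁻-Axiom (e · 𝟙 ≐ e)
  ·-zeroˡ   : ∀ e     → Mil⁻-Axiom (𝟘 · e ≐ 𝟘)
  ⋆-unfold  : ∀ e     → Mil⁻-Axiom (e ⋆ ≐ 𝟙 + e · e ⋆)
  ⋆-𝟙+      : ∀ e     → Mil⁻-Axiom (e ⋆ ≐ (𝟙 + e) ⋆)

-- A system whose rules are exactly those of equational logic, and whose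
-- axioms include ACI; it is determined by its set of axioms.
record ELSystem (A : Set) : Set₁ where
  field
    Axiom : Pred (Eq A) 0ℓ
    ACI⊑  : ACI ⊆ Axiom
open ELSystem public

Mil⁻ : {A : Set} → ELSystem A
Mil⁻ = record
  { Axiom = Mil⁻-Axiom
  ; ACI⊑  = λ where
      (+-assoc e f g) → +-assoc e f g
      (+-comm e f)    → +-comm e f
      (+-idem e)      → +-idem e
  }

_⊕_ : {A : Set} → ELSystem A → Pred (Eq A) 0ℓ → ELSystem A
S ⊕ Γ = record
  { Axiom = Axiom S ∪ Γ
  ; ACI⊑  = λ x → inj₁ (ACI⊑ S x)
  }

infix 3 _⊢_
data _⊢_ {A : Set} (S : ELSystem A) : Eq A → Set where
  axiom   : ∀ {eq} → Axiom S eq → S ⊢ eq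
  ⊢-refl  : ∀ {e} → S ⊢ e ≐ e
  ⊢-sym   : ∀ {e f} → S ⊢ e ≐ f → S ⊢ f ≐ e
  ⊢-trans : ∀ {e f g} → S ⊢ e ≐ f → S ⊢ f ≐ g → S ⊢ e ≐ g
  ⊢-cxt   : ∀ {e f} (C : Context A) → S ⊢ e ≐ f → S ⊢ C [ e ] ≐ C [ f ]

------------------------------------------------------------------------
-- 1-charts

data Label (A : Set) : Set where
  proper : A → Label A
  empty  : Label A

⟦_⟧ : {A : Set} → Label A → StExp A
⟦ proper a ⟧ = ` a
⟦ empty ⟧    = 𝟙

record 1-Chart (A : Set) : Set₁ where
  field
    V       : Set
    finite  : ∃[ n ] (V ↔ Fin n)
    start   : V
    _-⟨_⟩→_ : V → Label A → V → Set
    term    : V → Bool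
open 1-Chart using (V)

module _ {A : Set} (C : 1-Chart A) where
  open 1-Chart C hiding (V)

  WeaklyGuarded : Set
  WeaklyGuarded = ¬ (∃[ v ] TransClosure (λ u w → u -⟨ empty ⟩→ w) v v)

  τ : V C → StExp A
  τ v = if term v then 𝟙 else 𝟘

  -- ts is a (possibly redundant) list of all transitions from v.
  ListsTransitions : V C → List (Label A × V C) → Set
  ListsTransitions v ts = ∀ a w → ((a , w) ∈ ts) ⇔ (v -⟨ a ⟩→ w)

  -- By ACI, the choice of the list is irrelevant.  Only its existence forces
  -- the chart to be finitely branching.
  ProvableSolution : ELSystem A → (V C → StExp A) → Set
  ProvableSolution S s = ∀ v → ∃[ ts ]
    ( ListsTransitions v ts
    × (S ⊢ s v ≐ τ v + ∑ (map (λ (a , w) → ⟦ a ⟧ · s w) ts)))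

------------------------------------------------------------------------
-- Sub-1-charts and loop 1-charts

-- A sub-1-chart inherits immediate termination from C; its start vertex may
-- differ from that of C.
record Sub-1-Chart {A : Set} (C : 1-Chart A) : Set₁ where
  open 1-Chart C using (_-⟨_⟩→_)
  field
    vertex  : V C → Set
    start   : V C
    start∈  : vertex start
    edge    : V C → Label A → V C → Set
    edge⊆   : ∀ {u a w} → edge u a w → u -⟨ a ⟩→ w
    source∈ : ∀ {u a w} → edge u a w → vertex u
    target∈ : ∀ {u a w} → edge u a w → vertex w

module _ {A : Set} {C : 1-Chart A} where
  open 1-Chart C using (term)

  InfinitePath : Sub-1-Chart C → (ℕ → V C) → Set
  InfinitePath D π = ∀ i → ∃[ a ] edge (π i) a (π (suc i))
    where open Sub-1-Chart D

  record IsLoop (D : Sub-1-Chart C) : Set where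
    open Sub-1-Chart D
    field
      L1 : ∃[ π ] (π zero ≡ start × InfinitePath D π)
      L2 : ∀ π → π zero ≡ start → InfinitePath D π → ∃[ i ] π (suc i) ≡ start
      L3 : ∀ w → vertex w → T (term w) → w ≡ start

whole : {A : Set} (C : 1-Chart A) → Sub-1-Chart C
whole C = record
  { vertex  = λ _ → ⊤
  ; start   = start
  ; start∈  = _
  ; edge    = _-⟨_⟩→_
  ; edge⊆   = λ t → t
  ; source∈ = _
  ; target∈ = _
  }
  where open 1-Chart C

-- The vertices after the first one on paths in D that start at v with a
-- transition in U, and continue until v is reached again (if it ever is).
data Visited {A : Set} {C : 1-Chart A} (D : Sub-1-Chart C)
             (v : V C) (U : Label A → V C → Set) : V C → Set where
  enter : ∀ {a w} → U a w → Visited D v U w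
  move  : ∀ {u a w} → Visited D v U u → u ≢ v →
          Sub-1-Chart.edge D u a w → Visited D v U w

module _ {A : Set} {C : 1-Chart A} (D : Sub-1-Chart C) where
  open Sub-1-Chart D

  -- U a w stands for the transition from v to w with label a.
  generated : (v : V C) (U : Label A → V C → Set) →
              (∀ {a w} → U a w → edge v a w) → Sub-1-Chart C
  generated v U U⊆ = record
    { vertex  = λ w → w ≡ v ⊎ Visited D v U w
    ; start   = v
    ; start∈  = inj₁ refl
    ; edge    = λ u a w → (u ≡ v × U a w)
                        ⊎ (u ≢ v × Visited D v U u × edge u a w)
    ; edge⊆   = λ where
        (inj₁ (refl , x))  → edge⊆ (U⊆ x)
        (inj₂ (_ , _ , t)) → edge⊆ t
    ; source∈ = λ where
        (inj₁ (eq , _))    → inj₁ eq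
        (inj₂ (_ , r , _)) → inj₂ r
    ; target∈ = λ where
        (inj₁ (_ , x))      → inj₂ (enter x)
        (inj₂ (ne , r , t)) → inj₂ (move r ne t)
    }

  record LoopSub-1-Chart : Set₁ where
    field
      v        : V C
      v∈       : vertex v
      U        : Label A → V C → Set
      U⊆       : ∀ {a w} → U a w → edge v a w
      nonempty : ∃[ a ] ∃[ w ] U a w
      isLoop   : IsLoop (generated v U U⊆)

    LoopEntry : V C → Label A → V C → Set
    LoopEntry u a w = u ≡ v × U a w

    -- The start vertex does not belong to the body, also when it is the
    -- target of a body transition.
    Body : V C → Set
    Body w = w ≢ v × Visited D v U w

  record MultiStep : Set₁ where
    open LoopSub-1-Chart
    field
      pred-n      : ℕ
      loop        : Fin (suc pred-n) → LoopSub-1-Chart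
      disjoint    : ∀ {i j} → i ≢ j → ∀ {u a w} →
                    ¬ (LoopEntry (loop i) u a w × LoopEntry (loop j) u a w)
      notInBodies : ∀ {i j} → i ≢ j → ¬ Body (loop i) (v (loop j))

    EntryRemoved : V C → Label A → V C → Set
    EntryRemoved u a w = ∃[ i ] LoopEntry (loop i) u a w

    InSomeBody : V C → Set
    InSomeBody w = ∃[ i ] Body (loop i) w

  eliminate : MultiStep → Sub-1-Chart C
  eliminate M = record
    { vertex  = Reachable
    ; start   = start
    ; start∈  = ε
    ; edge    = λ u a w → Reachable u × Remaining u a w
    ; edge⊆   = λ (_ , t , _) → edge⊆ t
    ; source∈ = proj₁
    ; target∈ = λ {_} {a} (r , t) → r ◅◅ ((a , t) ◅ ε)
    }
    where
    open MultiStep M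
    Remaining : V C → Label A → V C → Set
    Remaining u a w = edge u a w × ¬ EntryRemoved u a w
    Reachable : V C → Set
    Reachable = Star (λ u w → ∃[ a ] Remaining u a w) start

data Run {A : Set} {C : 1-Chart A} (D : Sub-1-Chart C) : Set₁ where
  stop : Run D
  step : (M : MultiStep D) → Run (eliminate D M) → Run D

module _ {A : Set} {C : 1-Chart A} where

  Successful : {D : Sub-1-Chart C} → Run D → Set
  Successful {D} stop       = ¬ (∃[ π ] InfinitePath D π)
  Successful     (step _ r) = Successful r

  -- B collects the body vertices of the previously eliminated loops.
  LayeredFrom : (B : V C → Set) {D : Sub-1-Chart C} → Run D → Set
  LayeredFrom B stop       = ⊤
  LayeredFrom B (step M r) =
      (∀ {u a w} → EntryRemoved u a w → ¬ B u)
    × LayeredFrom (λ u → B u ⊎ InSomeBody u) r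
    where open MultiStep M

  Layered : {D : Sub-1-Chart C} → Run D → Set
  Layered = LayeredFrom (λ _ → ⊥)

  -- Multi-steps are counted from 1.
  RemovedIn : ℕ → {D : Sub-1-Chart C} → Run D →
              V C → Label A → V C → Set
  RemovedIn _             stop       _ _ _ = ⊥
  RemovedIn zero          (step _ _) _ _ _ = ⊥
  RemovedIn (suc zero)    (step M _) u a w = MultiStep.EntryRemoved M u a w
  RemovedIn (suc (suc n)) (step _ r) u a w = RemovedIn (suc n) r u a w

------------------------------------------------------------------------
-- LLEE-witnesses and coinductive proofs

module _ {A : Set} (C : 1-Chart A) where
  open 1-Chart C using (_-⟨_⟩→_)

  Labeling : Set
  Labeling = ∀ {u a w} → u -⟨ a ⟩→ w → ℕ

  -- Transitions that are never removed as loop-entry transitions thereby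
  -- carry the label 0.
  Records : Labeling → Run (whole C) → Set
  Records ℓ r = ∀ {u a w} (t : u -⟨ a ⟩→ w) →
                ∀ n → n ≥ 1 → (ℓ t ≡ n) ⇔ RemovedIn n r u a w

  IsLLEEWitness : Labeling → Set₁
  IsLLEEWitness ℓ = Σ (Run (whole C)) λ r →
                    Successful r × Layered r × Records ℓ r

  IsGuarded : Labeling → Set
  IsGuarded ℓ = ∀ {u a w} (t : u -⟨ a ⟩→ w) → ℓ t ≥ 1 → ∃[ b ] a ≡ proper b

  GuardedLLEE : Set₁
  GuardedLLEE = Σ Labeling λ ℓ → IsLLEEWitness ℓ × IsGuarded ℓ

record CoinductiveProof {A : Set} (S : ELSystem A) (eq : Eq A) : Set₁ where
  field
    chart         : 1-Chart A
    weaklyGuarded : WeaklyGuarded chart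
    L             : V chart → Eq A
    solution₁     : ProvableSolution chart S (lhs ∘ L)
    solution₂     : ProvableSolution chart S (rhs ∘ L)
    conclusion    : L (1-Chart.start chart) ≡ eq

LLEEWitnessed : {A : Set} {S : ELSystem A} {eq : Eq A} →
                CoinductiveProof S eq → Set₁
LLEEWitnessed P = GuardedLLEE (CoinductiveProof.chart P)

infix 3 _⊢LLEE_
_⊢LLEE_ : {A : Set} → ELSystem A → Eq A → Set₁
S ⊢LLEE eq = Σ (CoinductiveProof S eq) LLEEWitnessed

{-# OPTIONS --safe #-}

-- Every star expression is provably of the form (0 or 1) + P, where P does not
-- terminate immediately, and in P all left factors of products and all bodies
-- of stars can reach termination by proper steps.  Hence e and f* g both solve
-- x = P x + g' for one such P, or, when P cannot terminate and thus absorbs x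
-- on the right, x = P + g'.  A chart for this equation has as vertices x, a
-- final vertex, and one vertex for each right factor in P and g'.  A vertex is
-- left by 1-transitions to its continuation, or by proper transitions.  The
-- vertices can be numbered such that all transitions decrease the number, except
-- for proper transitions from x and from stars into their own bodies.  Bodies
-- are left only via their star.  Thus eliminating one loop after the other, in
-- decreasing order of the start vertices, is a layered successful run.

module Submission where

open import Defs
open import Data.Bool using (Bool; true; false; _∨_; T; if_then_else_)
open import Data.Empty using (⊥)
open import Data.Fin using (Fin; zero; toℕ; fromℕ<)
open import Data.Fin.Properties
  using (toℕ-injective; toℕ-fromℕ<; toℕ<n; toℕ-↑ˡ; toℕ-↑ʳ;
   0↔⊥; 1↔⊤; +↔⊎)
open import Data.List using (List; []; _∷_; _++_; map)
open import Data.List.Membership.Propositional using (_∈_)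
open import Data.List.Membership.Propositional.Properties using (∈-++⁻; ∈-++⁺ˡ; ∈-++⁺ʳ)
open import Data.List.Properties using (map-++)
open import Data.List.Relation.Unary.Any using (here; there)
import Data.Nat as ℕ
open import Data.Nat using (ℕ; zero; suc; z≤n; s≤s; _≤_; _<_)
open import Data.Nat.Induction using (Acc; acc; <-wellFounded)
open import Data.Nat.Properties
  using (_≟_; _<?_; ≤-refl; ≤-reflexive; <⇒≤; <⇒≱; ≮⇒≥; n<1+n; m<n⇒m<1+n;
         m<1+n⇒m<n∨m≡n; suc-injective; <-irrefl; <-trans; <-≤-trans; m≤m+n; +-monoʳ-<)
open import Data.Product using (Σ; ∃; ∃-syntax; _×_; _,_; proj₁; proj₂; map₂)
open import Data.Sum using (_⊎_; inj₁; inj₂)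
open import Data.Sum.Function.Propositional using (_⊎-↔_)
open import Data.Unit using (⊤; tt)
open import Function using (_∘_; id; _↔_; _⇔_; mk⇔; module Injection; module Inverse; module Equivalence)
open import Function.Properties.Inverse using (↔⇒↣; ↔-sym; ↔-trans)
open import Relation.Binary.Bundles using (Setoid)
open import Relation.Binary.Construct.Closure.ReflexiveTransitive
  using (Star; ε; _◅_; _◅◅_)
import Relation.Binary.Construct.Closure.ReflexiveTransitive as Star
open import Relation.Binary.Construct.Closure.Transitive using (TransClosure; [_]; _∷_)
open import Relation.Binary.PropositionalEquality
  using (_≡_; refl; sym; trans; cong; subst; subst₂)
import Relation.Binary.Reasoning.Setoid as SetoidReasoning
open import Relation.Nullary using (¬_; Dec; yes; no)
open import Relation.Nullary.Decidable using (map′)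
open import Relation.Nullary.Negation using (contradiction)
open import Relation.Unary using (｛_｝; _⊆_)

-- Charts with ranked vertices: eliminating loops in decreasing order of rank.

module RankedChart {A X : Set} {N : ℕ} (enum : X ↔ Fin N) (start : X)
                   (transitions : X → List (Label A × X)) (term : X → Bool) where

  chart : 1-Chart A
  chart = record
    { V       = X
    ; finite  = N , enum
    ; start   = start
    ; _-⟨_⟩→_ = λ u a w → (a , w) ∈ transitions u
    ; term    = term
    }

  rank : X → ℕ
  rank = toℕ ∘ Inverse.to enum

  rank-injective : ∀ {u w} → rank u ≡ rank w → u ≡ w
  rank-injective = Injection.injective (↔⇒↣ enum) ∘ toℕ-injective

  _≟ⱽ_ : (u w : X) → Dec (u ≡ w)
  u ≟ⱽ w = map′ rank-injective (cong rank) (rank u ≟ rank w)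

  Edge : X → Label A → X → Set
  Edge = 1-Chart._-⟨_⟩→_ chart

  Descent : X → X → Set
  Descent u w = ∃[ a ] Edge u a w × rank w < rank u

  -- These turn out to be exactly the loop-entry transitions of the witness. Membership is a
  -- comparison of ranks, so the labeling can be computed from it.
  Entry : X → Label A → X → Set
  Entry u a w = Edge u a w × rank u ≤ rank w

  -- The transitions that remain after the loop entries at the vertices of rank ≥ i
  -- have been removed.
  KeptBelow : ℕ → X → Label A → X → Set
  KeptBelow i u a w = Edge u a w × (rank w < rank u ⊎ rank u < i)

  KeptStep : ℕ → X → X → Set
  KeptStep i u w = ∃[ a ] KeptBelow i u a w

  ReachableBelow : ℕ → X → Set
  ReachableBelow i = Star (KeptStep i) start

  descent⇒kept : ∀ {i u w} → Descent u w → KeptStep i u w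
  descent⇒kept (a , t , lt) = a , t , inj₁ lt

  kept-suc : ∀ {i u a w} → KeptBelow i u a w → KeptBelow (suc i) u a w
  kept-suc (t , inj₁ lt) = t , inj₁ lt
  kept-suc (t , inj₂ lt) = t , inj₂ (m<n⇒m<1+n lt)

  kept-path-suc : ∀ {i u w} → Star (KeptStep i) u w → Star (KeptStep (suc i)) u w
  kept-path-suc = Star.map (map₂ kept-suc)

  -- In consists of the vertices of the body of the loop at v, and possibly of
  -- further ones that the loop entries do not reach.
  record LoopAt (v : X) : Set₁ where
    field
      In        : X → Set
      target    : ∀ {a w} → Entry v a w → w ≡ v ⊎ In w
      closed    : ∀ {u a w} → In u → Edge u a w → w ≡ v ⊎ In w
      above     : ∀ {u} → In u → rank v < rank u
      noTerm    : ∀ {u} → In u → ¬ T (term u)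
      guarded   : ∀ {a w} → Entry v a w → ∃[ b ] a ≡ proper b
      return    : ∃[ a ] ∃[ w ] Entry v a w × Star Descent w v
      reachable : ReachableBelow (rank v) v

  OnlyDescents : X → Set
  OnlyDescents v = ∀ {a w} → Edge v a w → rank w < rank v

  module Elimination (loops : ∀ v → LoopAt v ⊎ OnlyDescents v) where

    entry-guarded : ∀ {v a w} → Entry v a w → ∃[ b ] a ≡ proper b
    entry-guarded {v} (t , le) with loops v
    ... | inj₁ l  = LoopAt.guarded l (t , le)
    ... | inj₂ od = contradiction le (<⇒≱ (od t))

    -- A 1-transition that does not decrease the rank would be a loop entry, and those are proper.
    -- Hence a cycle of 1-transitions would decrease the rank of its own vertex.
    empty-descends : ∀ {u w} → Edge u empty w → rank w < rank u
    empty-descends {u} {w} t with rank w <? rank u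
    ... | yes lt = lt
    ... | no ¬lt with entry-guarded (t , ≮⇒≥ ¬lt)
    ...   | _ , ()

    weaklyGuarded : WeaklyGuarded chart
    weaklyGuarded (_ , c) = <-irrefl refl (descends c)
      where
      descends : ∀ {u w} → TransClosure (λ u w → Edge u empty w) u w → rank w < rank u
      descends [ t ]   = empty-descends t
      descends (t ∷ c) = <-trans (descends c) (empty-descends t)

    -- Completeness is restricted to reachable sources, since eliminations drop unreachable
    -- vertices. Soundness covers all transitions of D, because the initial chart is not pruned.
    record Invariant (i : ℕ) (D : Sub-1-Chart chart) : Set where
      open Sub-1-Chart D renaming (start to root)
      field
        root≡    : root ≡ start
        sound    : ∀ {u a w} → edge u a w → KeptBelow i u a w
        complete : ∀ {u a w} → Star (KeptStep i) root u → KeptBelow i u a w → edge u a w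
        vertices : ∀ {u} → Star (KeptStep i) root u → vertex u

    module Step {i v} (v≡i : rank v ≡ i) (l : LoopAt v)
                {D} (inv : Invariant (suc i) D) where
      open LoopAt l
      open Invariant inv
      open Sub-1-Chart D renaming (start to root)

      -- Multi-steps drop what becomes unreachable. The vertex v survives, as it is reached even
      -- without the loop entries at vertices of rank i or more.
      root⟶v : Star (KeptStep (suc i)) root v
      root⟶v rewrite root≡ = kept-path-suc (subst (λ j → ReachableBelow j v) v≡i reachable)

      v-kept : ∀ {a w} → Edge v a w → KeptBelow (suc i) v a w
      v-kept t = t , inj₂ (s≤s (≤-reflexive v≡i))

      U : Label A → X → Set
      U = Entry v

      U⊆ : ∀ {a w} → U a w → edge v a w
      U⊆ (t , _) = complete root⟶v (v-kept t)

      loopChart : Sub-1-Chart chart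
      loopChart = generated D v U U⊆

      -- The loop entries at ranks above i are already gone, and all of `In` lies there. So only
      -- descents are left inside the loop.
      edge-above : ∀ {u a w} → In u → edge u a w → Edge u a w × rank w < rank u
      edge-above inU t with sound t
      ... | t′ , inj₁ lt = t′ , lt
      ... | _  , inj₂ lt = contradiction lt (<⇒≱ (s≤s (subst (_< _) v≡i (above inU))))

      visited : ∀ {w} → Visited D v U w → w ≡ v ⊎ In w
      visited (enter x)     = target x
      visited (move r ne t) with visited r
      ... | inj₁ eq  = contradiction eq ne
      ... | inj₂ inU = closed inU (proj₁ (edge-above inU t))

      -- The invariant of the cyclic walk that witnesses (L1).
      OnCycle : X → Set
      OnCycle u = Star Descent u v × Star (KeptStep (suc i)) root u × (u ≡ v ⊎ Visited D v U u)

      advance : (x : ∃ OnCycle) → Σ (∃ OnCycle) λ y →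
                ∃[ a ] Sub-1-Chart.edge loopChart (proj₁ x) a (proj₁ y)
      advance (u , p , r , vis) with u ≟ⱽ v
      -- At v the entry from `return` is taken, and its descending path is stored. Elsewhere the
      -- walk consumes the stored path; `r` is carried along because `complete` asks for it.
      advance (u , p , r , vis) | yes refl =
        let a , w , x , q = return in
        (w , q , r ◅◅ ((a , v-kept (proj₁ x)) ◅ ε) , inj₂ (enter x)) , a , inj₁ (refl , x)
      advance (u , ε , r , vis) | no ne = contradiction refl ne
      advance (u , _ , r , inj₁ eq) | no ne = contradiction eq ne
      advance (u , (a , t , lt) ◅ p , r , inj₂ vis) | no ne =
        let t′ = complete r (t , inj₁ lt) in
        (_ , p , r ◅◅ ((a , t , inj₁ lt) ◅ ε) , inj₂ (move vis ne t′)) , a , inj₂ (ne , vis , t′)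

      walk : ℕ → ∃ OnCycle
      walk zero    = v , ε , root⟶v , inj₁ refl
      walk (suc n) = proj₁ (advance (walk n))

      -- Away from v every transition of the loop chart descends. The induction starts at the second
      -- vertex of the path, since the first transition is a loop entry and may raise the rank.
      comesBack : ∀ {π} → InfinitePath loopChart π →
                  ∀ n → Acc _<_ (rank (π (suc n))) → ∃[ m ] π (suc m) ≡ v
      comesBack inf n (acc rs) with inf (suc n)
      ... | _ , inj₁ (eq , _)       = n , eq
      ... | _ , inj₂ (ne , vis , t) with visited vis
      ...   | inj₁ eq  = contradiction eq ne
      ...   | inj₂ inU = comesBack inf (suc n) (rs (proj₂ (edge-above inU t)))

      isLoop : IsLoop loopChart
      isLoop = record
        { L1 = proj₁ ∘ walk , refl , λ n → proj₂ (advance (walk n))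
        ; L2 = λ π _ inf → comesBack inf 0 (<-wellFounded _)
        ; L3 = λ where
            w (inj₁ eq)  _ → eq
            w (inj₂ vis) t → nonterminating vis t
        }
        where
        nonterminating : ∀ {w} → Visited D v U w → T (term w) → w ≡ v
        nonterminating vis t with visited vis
        ... | inj₁ eq  = eq
        ... | inj₂ inW = contradiction t (noTerm inW)

      multiStep : MultiStep D
      multiStep = record
        -- A single loop per multi-step makes the two conditions on pairs of loops vacuous.
        { pred-n      = 0
        ; loop        = λ _ → record
            { v        = v
            ; v∈       = vertices root⟶v
            ; U        = U
            ; U⊆       = U⊆
            ; nonempty = let a , w , x , _ = return in a , w , x
            ; isLoop   = isLoop
            }
        ; disjoint    = λ { {zero} {zero} i≢j → contradiction refl i≢j }
        ; notInBodies = λ { {zero} {zero} i≢j → contradiction refl i≢j }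
        }

      open MultiStep multiStep using (EntryRemoved; InSomeBody) public

      -- Later multi-steps remove entries only at ranks below i, hence never at a vertex of this
      -- body. This gives layeredness.
      inSomeBody-above : ∀ {u} → InSomeBody u → i < rank u
      inSomeBody-above (_ , ne , vis) with visited vis
      ... | inj₁ eq  = contradiction eq ne
      ... | inj₂ inU = subst (_< _) v≡i (above inU)

      private
        remaining : ∀ {u a w} → Star (KeptStep (suc i)) root u → KeptBelow i u a w →
                    edge u a w × ¬ EntryRemoved u a w
        remaining r k = complete r (kept-suc k) , notRemoved k
          where
          notRemoved : ∀ {u a w} → KeptBelow i u a w → ¬ EntryRemoved u a w
          notRemoved (_ , inj₁ lt) (_ , refl , _ , le) = <⇒≱ lt le
          notRemoved (_ , inj₂ lt) (_ , refl , _)      = <-irrefl v≡i lt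

        reach : ∀ {x u} → Star (KeptStep (suc i)) root x → Star (KeptStep i) x u →
                Star (λ u w → ∃[ a ] edge u a w × ¬ EntryRemoved u a w) x u
        reach r ε             = ε
        reach r ((a , k) ◅ p) =
          (a , remaining r k) ◅ reach (r ◅◅ ((a , kept-suc k) ◅ ε)) p

        kept-pred : ∀ {u a w} → KeptBelow (suc i) u a w → ¬ EntryRemoved u a w → KeptBelow i u a w
        kept-pred (t , inj₁ lt) _ = t , inj₁ lt
        kept-pred {u} {_} {w} (t , inj₂ lt) ¬rem with m<1+n⇒m<n∨m≡n lt
        ... | inj₁ lt′ = t , inj₂ lt′
        ... | inj₂ eq with rank-injective (trans eq (sym v≡i)) | rank w <? rank u
        ...   | refl | yes d = t , inj₁ d
        ...   | refl | no ¬d = contradiction (zero , refl , t , ≮⇒≥ ¬d) ¬rem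

      invariant : Invariant i (eliminate D multiStep)
      invariant = record
        { root≡    = root≡
        ; sound    = λ (_ , t , ¬rem) → kept-pred (sound t) ¬rem
        ; complete = λ r k → reach ε r , remaining (kept-path-suc r) k
        ; vertices = reach ε
        }

    -- A vertex without loop entries yields no loop to eliminate, so no multi-step is spent on it;
    -- lowering the bound past its rank changes none of the kept transitions.
    skip : ∀ {i v D} → rank v ≡ i → OnlyDescents v → Invariant (suc i) D → Invariant i D
    skip {i} {v} {D} v≡i od inv = record
      { root≡    = root≡
      ; sound    = pred ∘ sound
      ; complete = λ r k → complete (kept-path-suc r) (kept-suc k)
      ; vertices = vertices ∘ kept-path-suc
      }
      where
      open Invariant inv
      pred : ∀ {u a w} → KeptBelow (suc i) u a w → KeptBelow i u a w
      pred (t , inj₁ lt) = t , inj₁ lt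
      pred (t , inj₂ lt) with m<1+n⇒m<n∨m≡n lt
      ... | inj₁ lt′ = t , inj₂ lt′
      ... | inj₂ eq with rank-injective (trans eq (sym v≡i))
      ...   | refl = t , inj₁ (od t)

    -- `layered` ranges over all admissible B, because the set of recorded body vertices grows along
    -- the run. `position` counts the multi-steps before the one at a vertex; as multi-steps are
    -- numbered from 1, the marking label is its successor.
    record Eliminated (i : ℕ) (D : Sub-1-Chart chart) : Set₁ where
      field
        run        : Run D
        successful : Successful run
        layered    : (B : X → Set) → (∀ {u} → B u → i ≤ rank u) → LayeredFrom B run
        removed    : ∀ {n u a w} → RemovedIn n run u a w → Entry u a w × rank u < i
        position   : X → ℕ
        records    : ∀ {u a w} → Entry u a w → rank u < i →
                     ∀ n → (position u ≡ n) ⇔ RemovedIn (suc n) run u a w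

    -- The enumeration is a bijection, so each number below N is the rank of exactly one vertex, and
    -- the induction treats one vertex at a time. At bound 0 only descents are left.
    run : ∀ i → i ≤ N → ∀ {D} → Invariant i D → Eliminated i D
    run zero _ {D} inv = record
      { run        = stop
      ; successful = λ (π , inf) → noInfinitePath inf 0 (<-wellFounded _)
      ; layered    = λ _ _ → tt
      ; removed    = λ ()
      ; position   = λ _ → 0
      ; records    = λ _ ()
      }
      where
      noInfinitePath : ∀ {π} → InfinitePath D π → ∀ n → ¬ Acc _<_ (rank (π n))
      noInfinitePath inf n (acc rs) with Invariant.sound inv (proj₂ (inf n))
      ... | _ , inj₁ lt = noInfinitePath inf (suc n) (rs lt)
    run (suc i) i<N {D} inv = go (loops v)
      where
      v : X
      v = Inverse.from enum (fromℕ< i<N)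
      v≡i : rank v ≡ i
      v≡i = trans (cong toℕ (Inverse.strictlyInverseˡ enum _)) (toℕ-fromℕ< i<N)

      go : LoopAt v ⊎ OnlyDescents v → Eliminated (suc i) D
      go (inj₂ od) = record
        { run        = E.run
        ; successful = E.successful
        ; layered    = λ B le → E.layered B (<⇒≤ ∘ le)
        ; removed    = λ x → let y , lt = E.removed x in y , m<n⇒m<1+n lt
        ; position   = E.position
        ; records    = λ {u} x lt → E.records x (below x lt)
        }
        where
        module E = Eliminated (run i (<⇒≤ i<N) (skip v≡i od inv))
        below : ∀ {u a w} → Entry u a w → rank u < suc i → rank u < i
        below (t , le) lt with m<1+n⇒m<n∨m≡n lt
        ... | inj₁ lt′ = lt′
        ... | inj₂ eq with rank-injective (trans eq (sym v≡i))
        ...   | refl = contradiction le (<⇒≱ (od t))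
      go (inj₁ l) = record
        { run        = step S.multiStep E.run
        ; successful = E.successful
        ; layered    = λ B le →
            (λ { (_ , refl , _) b → <-irrefl (sym v≡i) (le b) }) ,
            E.layered _ λ { (inj₁ b) → <⇒≤ (le b)
                          ; (inj₂ b) → <⇒≤ (S.inSomeBody-above b) }
        ; removed    = λ {n} → removed {n}
        ; position   = position
        ; records    = records
        }
        where
        module S = Step v≡i l inv
        module E = Eliminated (run i (<⇒≤ i<N) S.invariant)

        removed : ∀ {n u a w} → RemovedIn n (step S.multiStep E.run) u a w →
                  Entry u a w × rank u < suc i
        removed {suc zero}    (_ , refl , x) = x , s≤s (≤-reflexive v≡i)
        removed {suc (suc n)} x              = let y , lt = E.removed x in y , m<n⇒m<1+n lt

        position : X → ℕ
        position u with u ≟ⱽ v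
        ... | yes _ = 0
        ... | no _  = suc (E.position u)

        records : ∀ {u a w} → Entry u a w → rank u < suc i → ∀ n →
                  (position u ≡ n) ⇔ RemovedIn (suc n) (step S.multiStep E.run) u a w
        records {u} x lt n with u ≟ⱽ v
        records x lt zero    | yes refl = mk⇔ (λ _ → zero , refl , x) (λ _ → refl)
        records x lt (suc n) | yes refl =
          mk⇔ (λ ()) (λ y → contradiction (proj₂ (E.removed y)) (<-irrefl v≡i))
        records x lt zero    | no ne    = mk⇔ (λ ()) (λ (_ , eq , _) → contradiction eq ne)
        records x lt (suc n) | no ne    =
          mk⇔ (λ eq → Equivalence.to (rec n) (suc-injective eq))
              (λ y → cong suc (Equivalence.from (rec n) y))
          where
          rec = E.records x (below lt)
            where
            below : rank _ < suc i → rank _ < i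
            below lt with m<1+n⇒m<n∨m≡n lt
            ... | inj₁ lt′ = lt′
            ... | inj₂ eq  = contradiction (rank-injective (trans eq (sym v≡i))) ne

    guardedLLEE : GuardedLLEE chart
    guardedLLEE = ℓ , (E.run , E.successful , E.layered _ (λ ()) , records) , isGuarded
      where
      rank<N : ∀ u → rank u < N
      rank<N u = toℕ<n (Inverse.to enum u)

      initial : Invariant N (whole chart)
      initial = record
        { root≡    = refl
        ; sound    = λ {u} t → t , inj₂ (rank<N u)
        ; complete = λ _ → proj₁
        ; vertices = λ _ → tt
        }

      module E = Eliminated (run N ≤-refl initial)

      ℓ : Labeling chart
      ℓ {u} {_} {w} _ with rank w <? rank u
      ... | yes _ = 0
      ... | no _  = suc (E.position u)

      records : Records chart ℓ E.run
      records {u} {a} {w} t (suc n) _ with rank w <? rank u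
      ... | yes lt = mk⇔ (λ ()) (λ x → contradiction (proj₂ (proj₁ (E.removed x))) (<⇒≱ lt))
      ... | no ¬lt = mk⇔ (λ eq → Equivalence.to (rec n) (suc-injective eq))
                         (λ x → cong suc (Equivalence.from (rec n) x))
        where rec = E.records (t , ≮⇒≥ ¬lt) (rank<N u)

      isGuarded : IsGuarded chart ℓ
      isGuarded {u} {a} {w} t pos with rank w <? rank u
      ... | no ¬lt = entry-guarded (t , ≮⇒≥ ¬lt)

-- Finite sets ordered by an enumeration.

Finite : Set → Set
Finite X = ∃[ n ] (X ↔ Fin n)

-- The left summand receives the smaller indices. The order of summands in a vertex type thereby
-- determines the ranks.
_⊎ᶠ_ : {X Y : Set} → Finite X → Finite Y → Finite (X ⊎ Y)
(m , f) ⊎ᶠ (n , g) = _ , ↔-trans (f ⊎-↔ g) (↔-sym (+↔⊎ {m} {n}))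

index : ∀ {X} → Finite X → X → ℕ
index (_ , f) = toℕ ∘ Inverse.to f

-- A record rather than a synonym, so that x and y can be inferred from the type.
record _≺[_]_ {X : Set} (x : X) (f : Finite X) (y : X) : Set where
  constructor index<
  field
    index-< : index f x < index f y
open _≺[_]_

module _ {X Y : Set} (f : Finite X) (g : Finite Y) where

  index-inj₁ : ∀ x → index (f ⊎ᶠ g) (inj₁ x) ≡ index f x
  index-inj₁ x = toℕ-↑ˡ _ _

  index-inj₂ : ∀ y → index (f ⊎ᶠ g) (inj₂ y) ≡ proj₁ f ℕ.+ index g y
  index-inj₂ y = toℕ-↑ʳ (proj₁ f) _

  inj₁-mono : ∀ {x y} → x ≺[ f ] y → inj₁ x ≺[ f ⊎ᶠ g ] inj₁ y
  inj₁-mono (index< lt) = index< (subst₂ _<_ (sym (index-inj₁ _)) (sym (index-inj₁ _)) lt)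

  inj₂-mono : ∀ {x y} → x ≺[ g ] y → inj₂ x ≺[ f ⊎ᶠ g ] inj₂ y
  inj₂-mono (index< lt) = index<
    (subst₂ _<_ (sym (index-inj₂ _)) (sym (index-inj₂ _)) (+-monoʳ-< (proj₁ f) lt))

  inj₁≺inj₂ : ∀ {x y} → inj₁ x ≺[ f ⊎ᶠ g ] inj₂ y
  inj₁≺inj₂ {x} {y} = index< (subst₂ _<_ (sym (index-inj₁ x)) (sym (index-inj₂ y))
    (<-≤-trans (toℕ<n (Inverse.to (proj₂ f) x)) (m≤m+n _ _)))

⊤-finite : Finite ⊤
⊤-finite = 1 , ↔-sym 1↔⊤

⊥-finite : Finite ⊥
⊥-finite = 0 , ↔-sym 0↔⊥

-- Non-terminating expressions and their chart fragments.

-- The non-terminating expressions; the index says whether termination is reachable.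
data Form (A : Set) : Bool → Set where
  nil  : Form A false
  act  : A → Form A true
  plus : ∀ {b c} → Form A b → Form A c → Form A (b ∨ c)
  seq  : ∀ {c} → Form A true → (t : Bool) → Form A c → Form A (t ∨ c)
  iter : Form A true → Form A true → Form A true

opt : {A : Set} → Bool → StExp A
opt t = if t then 𝟙 else 𝟘

-- In `seq P t Q` the flag `t` is the immediate termination split off from the right factor. In
-- `iter P Q` the first pass P is separate from the star body Q, so that it has its own vertices
-- outside the loop.
expr : ∀ {A b} → Form A b → StExp A
expr nil         = 𝟘
expr (act a)     = ` a
expr (plus P Q)  = expr P + expr Q
expr (seq P t Q) = expr P · (opt t + expr Q)
expr (iter P Q)  = expr P · expr Q ⋆

-- A vertex for each right factor, from which this factor and then its continuation
-- remain to be executed.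
Pos : ∀ {A b} → Form A b → Set
Pos nil         = ⊥
Pos (act _)     = ⊥
Pos (plus P Q)  = Pos P ⊎ Pos Q
Pos (seq P t Q) = Pos Q ⊎ (⊤ ⊎ Pos P)
Pos (iter P Q)  = ⊤ ⊎ (Pos Q ⊎ Pos P)

-- Lists the vertices for iter P Q in the order: the star, its body Q, then P; but
-- those for seq P t Q in the order: Q, the factor itself, then P.  So transitions
-- other than loop entries decrease the index.
finitePos : ∀ {A b} (P : Form A b) → Finite (Pos P)
finitePos nil         = ⊥-finite
finitePos (act _)     = ⊥-finite
finitePos (plus P Q)  = finitePos P ⊎ᶠ finitePos Q
finitePos (seq P t Q) = finitePos Q ⊎ᶠ (⊤-finite ⊎ᶠ finitePos P)
finitePos (iter P Q)  = ⊤-finite ⊎ᶠ (finitePos Q ⊎ᶠ finitePos P)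

-- Immediate termination of a right factor becomes a 1-transition to the continuation, since (L3)
-- forbids termination at vertices inside a loop.
exit : {A X : Set} → Bool → X → List (Label A × X)
exit t k = if t then (empty , k) ∷ [] else []

module _ {A X : Set} where

  -- Initial transitions of P when the vertices of P are embedded by i, and execution
  -- continues at k after P.
  init : ∀ {b} (P : Form A b) → (Pos P → X) → X → List (Label A × X)
  init nil         i k = []
  init (act a)     i k = (proper a , k) ∷ []
  init (plus P Q)  i k = init P (i ∘ inj₁) k ++ init Q (i ∘ inj₂) k
  init (seq P t Q) i k = init P (i ∘ inj₂ ∘ inj₂) (i (inj₂ (inj₁ tt)))
  init (iter P Q)  i k = init P (i ∘ inj₂ ∘ inj₂) (i (inj₁ tt))

  steps : ∀ {b} (P : Form A b) → (Pos P → X) → X → Pos P → List (Label A × X)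
  steps (plus P Q)  i k (inj₁ x)        = steps P (i ∘ inj₁) k x
  steps (plus P Q)  i k (inj₂ y)        = steps Q (i ∘ inj₂) k y
  steps (seq P t Q) i k (inj₁ y)        = steps Q (i ∘ inj₁) k y
  steps (seq P t Q) i k (inj₂ (inj₁ _)) = exit t k ++ init Q (i ∘ inj₁) k
  steps (seq P t Q) i k (inj₂ (inj₂ x)) = steps P (i ∘ inj₂ ∘ inj₂) (i (inj₂ (inj₁ tt))) x
  steps (iter P Q)  i k (inj₁ _)        = exit true k ++ init Q (i ∘ inj₂ ∘ inj₁) (i (inj₁ tt))
  steps (iter P Q)  i k (inj₂ (inj₁ y)) = steps Q (i ∘ inj₂ ∘ inj₁) (i (inj₁ tt)) y
  steps (iter P Q)  i k (inj₂ (inj₂ x)) = steps P (i ∘ inj₂ ∘ inj₂) (i (inj₁ tt)) x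

  exit-target : ∀ t {k : X} {a w} → (a , w) ∈ exit {A} t k → w ≡ k
  exit-target true (here refl) = refl

  init-proper : ∀ {b} (P : Form A b) {i k a w} → (a , w) ∈ init P i k → ∃[ c ] a ≡ proper c
  init-proper (act a) (here refl) = a , refl
  init-proper (plus P Q) {i} x with ∈-++⁻ (init P (i ∘ inj₁) _) x
  ... | inj₁ y = init-proper P y
  ... | inj₂ y = init-proper Q y
  init-proper (seq P t Q) x = init-proper P x
  init-proper (iter P Q)  x = init-proper P x

  private
    via : ∀ {Y Z : Set} {i : Z → X} {k z w} (j : Y → Z) →
          w ≡ i z ⊎ (∃[ y ] w ≡ i (j y)) → w ≡ k ⊎ (∃[ y ] w ≡ i y)
    via j (inj₁ eq)       = inj₂ (_ , eq)
    via j (inj₂ (y , eq)) = inj₂ (j y , eq)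

    along : ∀ {Y Z : Set} {i : Z → X} {k w} (j : Y → Z) →
            w ≡ k ⊎ (∃[ y ] w ≡ i (j y)) → w ≡ k ⊎ (∃[ y ] w ≡ i y)
    along j (inj₁ eq)       = inj₁ eq
    along j (inj₂ (y , eq)) = inj₂ (j y , eq)

  init-targets : ∀ {b} (P : Form A b) {i k a w} → (a , w) ∈ init P i k →
                 w ≡ k ⊎ (∃[ y ] w ≡ i y)
  init-targets (act a) (here refl) = inj₁ refl
  init-targets (plus P Q) {i} x with ∈-++⁻ (init P (i ∘ inj₁) _) x
  ... | inj₁ y = along inj₁ (init-targets P y)
  ... | inj₂ y = along inj₂ (init-targets Q y)
  init-targets (seq P t Q) x = via (inj₂ ∘ inj₂) (init-targets P x)
  init-targets (iter P Q)  x = via (inj₂ ∘ inj₂) (init-targets P x)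

  -- Applied to a star body, whose continuation is the star, this says that the body is left only
  -- via the star.
  steps-targets : ∀ {b} (P : Form A b) {i k a w} y → (a , w) ∈ steps P i k y →
                  w ≡ k ⊎ (∃[ y ] w ≡ i y)
  steps-targets (plus P Q)  (inj₁ y) x = along inj₁ (steps-targets P y x)
  steps-targets (plus P Q)  (inj₂ y) x = along inj₂ (steps-targets Q y x)
  steps-targets (seq P t Q) (inj₁ y) x = along inj₁ (steps-targets Q y x)
  steps-targets (seq P t Q) (inj₂ (inj₁ _)) x with ∈-++⁻ (exit t _) x
  ... | inj₁ y = inj₁ (exit-target t y)
  ... | inj₂ y = along inj₁ (init-targets Q y)
  steps-targets (seq P t Q) (inj₂ (inj₂ y)) x = via (inj₂ ∘ inj₂) (steps-targets P y x)
  steps-targets (iter P Q)  (inj₁ _) (here refl) = inj₁ refl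
  steps-targets (iter P Q)  (inj₁ _) (there x)   = via (inj₂ ∘ inj₁) (init-targets Q x)
  steps-targets (iter P Q)  (inj₂ (inj₁ y)) x = via (inj₂ ∘ inj₁) (steps-targets Q y x)
  steps-targets (iter P Q)  (inj₂ (inj₂ y)) x = via (inj₂ ∘ inj₂) (steps-targets P y x)

-- Fragments placed in a ranked chart, and the loops at their vertices.

module Placements {A X : Set} {N : ℕ} (enum : X ↔ Fin N) (start : X)
                  (transitions : X → List (Label A × X)) (term : X → Bool) where
  open RankedChart enum start transitions term

  -- Ranks only have to respect the order of indices and need not be consecutive, so a placement
  -- restricts to all subexpressions.
  record Placement {b} (P : Form A b) (i : Pos P → X) (k : X) : Set where
    field
      transitions≡ : ∀ x → transitions (i x) ≡ steps P i k x
      mono         : ∀ {x y} → x ≺[ finitePos P ] y → rank (i x) < rank (i y)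
      above        : ∀ x → rank k < rank (i x)
      noTerm       : ∀ x → ¬ T (term (i x))

    edge : ∀ {x a w} → (a , w) ∈ steps P i k x → Edge (i x) a w
    edge {x} {a} {w} = subst ((a , w) ∈_) (sym (transitions≡ x))

    edge⁻¹ : ∀ {x a w} → Edge (i x) a w → (a , w) ∈ steps P i k x
    edge⁻¹ {x} {a} {w} = subst ((a , w) ∈_) (transitions≡ x)

    init-above : ∀ {a w} → (a , w) ∈ init P i k → rank k ≤ rank w
    init-above x with init-targets P x
    ... | inj₁ refl       = ≤-refl
    ... | inj₂ (_ , refl) = <⇒≤ (above _)

  open Placement

  plusˡ : ∀ {b c} {P : Form A b} {Q : Form A c} {i k} →
          Placement (plus P Q) i k → Placement P (i ∘ inj₁) k
  plusˡ {P = P} {Q} pl = record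
    { transitions≡ = transitions≡ pl ∘ inj₁
    ; mono         = mono pl ∘ inj₁-mono (finitePos P) (finitePos Q)
    ; above        = above pl ∘ inj₁
    ; noTerm       = noTerm pl ∘ inj₁
    }

  plusʳ : ∀ {b c} {P : Form A b} {Q : Form A c} {i k} →
          Placement (plus P Q) i k → Placement Q (i ∘ inj₂) k
  plusʳ {P = P} {Q} pl = record
    { transitions≡ = transitions≡ pl ∘ inj₂
    ; mono         = mono pl ∘ inj₂-mono (finitePos P) (finitePos Q)
    ; above        = above pl ∘ inj₂
    ; noTerm       = noTerm pl ∘ inj₂
    }

  seqˡ : ∀ {c P t} {Q : Form A c} {i k} → Placement (seq P t Q) i k →
         Placement P (i ∘ inj₂ ∘ inj₂) (i (inj₂ (inj₁ tt)))
  seqˡ {P = P} {Q = Q} pl = record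
    { transitions≡ = transitions≡ pl ∘ inj₂ ∘ inj₂
    ; mono         = mono pl ∘ inj₂-mono (finitePos Q) (⊤-finite ⊎ᶠ finitePos P)
                             ∘ inj₂-mono ⊤-finite (finitePos P)
    ; above        = λ x → mono pl (inj₂-mono (finitePos Q) (⊤-finite ⊎ᶠ finitePos P)
                                     (inj₁≺inj₂ ⊤-finite (finitePos P) {y = x}))
    ; noTerm       = noTerm pl ∘ inj₂ ∘ inj₂
    }

  seqʳ : ∀ {c P t} {Q : Form A c} {i k} → Placement (seq P t Q) i k →
         Placement Q (i ∘ inj₁) k
  seqʳ {P = P} {Q = Q} pl = record
    { transitions≡ = transitions≡ pl ∘ inj₁
    ; mono         = mono pl ∘ inj₁-mono (finitePos Q) (⊤-finite ⊎ᶠ finitePos P)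
    ; above        = above pl ∘ inj₁
    ; noTerm       = noTerm pl ∘ inj₁
    }

  -- This is what listing Q before the factor itself in `finitePos` achieves: both the continuation
  -- and Q lie below the factor, so no loop starts there.
  seq-descends : ∀ {c P t} {Q : Form A c} {i k} → Placement (seq P t Q) i k →
                 OnlyDescents (i (inj₂ (inj₁ tt)))
  seq-descends {P = P} {t} {Q} pl x with ∈-++⁻ (exit t _) (edge⁻¹ pl x)
  ... | inj₁ y with refl ← exit-target t y = above pl _
  ... | inj₂ y with init-targets Q y
  ...   | inj₁ refl       = above pl _
  ...   | inj₂ (z , refl) =
    mono pl (inj₁≺inj₂ (finitePos Q) (⊤-finite ⊎ᶠ finitePos P) {x = z})

  iterˡ : ∀ {P Q i k} → Placement (iter P Q) i k →
          Placement P (i ∘ inj₂ ∘ inj₂) (i (inj₁ tt))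
  iterˡ {P = P} {Q} pl = record
    { transitions≡ = transitions≡ pl ∘ inj₂ ∘ inj₂
    ; mono         = mono pl ∘ inj₂-mono ⊤-finite (finitePos Q ⊎ᶠ finitePos P)
                             ∘ inj₂-mono (finitePos Q) (finitePos P)
    ; above        = λ x → mono pl (inj₁≺inj₂ ⊤-finite (finitePos Q ⊎ᶠ finitePos P) {y = inj₂ x})
    ; noTerm       = noTerm pl ∘ inj₂ ∘ inj₂
    }

  iterʳ : ∀ {P Q i k} → Placement (iter P Q) i k →
          Placement Q (i ∘ inj₂ ∘ inj₁) (i (inj₁ tt))
  iterʳ {P = P} {Q} pl = record
    { transitions≡ = transitions≡ pl ∘ inj₂ ∘ inj₁
    ; mono         = mono pl ∘ inj₂-mono ⊤-finite (finitePos Q ⊎ᶠ finitePos P)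
                             ∘ inj₁-mono (finitePos Q) (finitePos P)
    ; above        = λ y → mono pl (inj₁≺inj₂ ⊤-finite (finitePos Q ⊎ᶠ finitePos P) {y = inj₁ y})
    ; noTerm       = noTerm pl ∘ inj₂ ∘ inj₁
    }

  Returning : ∀ {b} (P : Form A b) → (Pos P → X) → X → Set
  Returning P i k = ∃[ a ] ∃[ w ] (a , w) ∈ init P i k × Star Descent w k

  -- A normed P can be passed through with descents only, after its first transition: stars are left
  -- at once by their 1-transition, and a factor is left by its own or else through its normed rest.
  -- The index is constrained by an equation because it is computed by `_∨_`.
  returning : ∀ {b} (P : Form A b) {i k} → b ≡ true → Placement P i k → Returning P i k
  returning (act a) _ pl = proper a , _ , here refl , ε
  returning (plus {true} P Q) _ pl =
    let a , w , x , p = returning P refl (plusˡ pl) in a , w , ∈-++⁺ˡ x , p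
  returning (plus {false} P Q) {i} eq pl =
    let a , w , x , p = returning Q eq (plusʳ pl) in
    a , w , ∈-++⁺ʳ (init P (i ∘ inj₁) _) x , p
  returning (seq P true Q) _ pl =
    let a , w , x , p = returning P refl (seqˡ pl)
        t             = edge pl (here refl)
    in a , w , x , p ◅◅ ((empty , t , above pl _) ◅ ε)
  returning (seq P false Q) eq pl =
    let a , w , x , p = returning P refl (seqˡ pl)
        b , u , y , q = returning Q eq (seqʳ pl)
        t             = edge pl {inj₂ (inj₁ tt)} y
    in a , w , x , p ◅◅ ((b , t , seq-descends pl t) ◅ q)
  returning (iter P Q) _ pl =
    let a , w , x , p = returning P refl (iterˡ pl)
    in a , w , x , p ◅◅ ((empty , edge pl (here refl) , above pl _) ◅ ε)

  loopAt : ∀ {Q : Form A true} {i v} → Placement Q i v →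
           (∀ {a w} → Edge v a w → rank w < rank v ⊎ (a , w) ∈ init Q i v) →
           (∀ {a w} → (a , w) ∈ init Q i v → Edge v a w) →
           ReachableBelow (rank v) v → LoopAt v
  loopAt {Q} {i} {v} pl split into reach = record
    { In        = λ u → ∃[ y ] u ≡ i y
    ; target    = init-targets Q ∘ entry
    ; closed    = λ { (y , refl) t → steps-targets Q y (edge⁻¹ pl t) }
    ; above     = λ { (y , refl) → above pl y }
    ; noTerm    = λ { (y , refl) → noTerm pl y }
    ; guarded   = init-proper Q ∘ entry
    ; return    = let a , w , x , p = returning Q refl pl in
                  a , w , (into x , init-above pl x) , p
    ; reachable = reach
    }
    where
    entry : ∀ {a w} → Entry v a w → (a , w) ∈ init Q i v
    entry (t , le) with split t
    ... | inj₁ lt = contradiction le (<⇒≱ lt)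
    ... | inj₂ x  = x

  Entered : ∀ {b} → ℕ → (P : Form A b) → (Pos P → X) → X → Set
  Entered m P i k = ∀ {a w} → (a , w) ∈ init P i k → ReachableBelow m w

  return-reachable : ∀ {m} (P : Form A true) {i k} → Placement P i k → Entered m P i k →
                     ReachableBelow m k
  return-reachable P pl ent =
    let _ , _ , x , p = returning P refl pl in ent x ◅◅ Star.map descent⇒kept p

  reachable-mono : ∀ {m n u} → m ≤ n → ReachableBelow m u → ReachableBelow n u
  reachable-mono m≤n = Star.map λ where
    (a , t , inj₁ lt) → a , t , inj₁ lt
    (a , t , inj₂ lt) → a , t , inj₂ (<-≤-trans lt m≤n)

  reachable-entry : ∀ {u a w} → ReachableBelow (rank u) u → Edge u a w →
                    ReachableBelow (suc (rank u)) w
  reachable-entry r t =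
    reachable-mono (<⇒≤ (n<1+n _)) r ◅◅ ((_ , t , inj₂ (n<1+n _)) ◅ ε)

  -- The fragment is entered using loop entries only at ranks below m, and all of its vertices have
  -- rank at least m, so it stays reachable while its own loops are eliminated. Inside a star body,
  -- m becomes one more than the rank of the star.
  placement-loops : ∀ {b m} (P : Form A b) {i k} → Placement P i k →
                    (∀ x → m ≤ rank (i x)) → Entered m P i k →
                    ∀ x → LoopAt (i x) ⊎ OnlyDescents (i x)
  placement-loops (plus P Q) pl bound ent (inj₁ x) =
    placement-loops P (plusˡ pl) (bound ∘ inj₁) (ent ∘ ∈-++⁺ˡ) x
  placement-loops (plus P Q) {i} pl bound ent (inj₂ y) =
    placement-loops Q (plusʳ pl) (bound ∘ inj₂) (ent ∘ ∈-++⁺ʳ (init P (i ∘ inj₁) _)) y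
  placement-loops (seq P t Q) pl bound ent (inj₁ y) =
    placement-loops Q (seqʳ pl) (bound ∘ inj₁) ent′ y
    where
    ent′ : Entered _ Q _ _
    ent′ x = let t = edge pl {inj₂ (inj₁ tt)} (∈-++⁺ʳ (exit t _) x) in
      return-reachable P (seqˡ pl) ent ◅◅ ((_ , t , inj₁ (seq-descends pl t)) ◅ ε)
  placement-loops (seq P t Q) pl bound ent (inj₂ (inj₁ _)) = inj₂ (seq-descends pl)
  placement-loops (seq P t Q) pl bound ent (inj₂ (inj₂ x)) =
    placement-loops P (seqˡ pl) (bound ∘ inj₂ ∘ inj₂) ent x
  placement-loops (iter P Q) {i} {k} pl bound ent (inj₁ _) =
    inj₁ (loopAt (iterʳ pl) split (edge pl ∘ there)
      (reachable-mono (bound _) (return-reachable P (iterˡ pl) ent)))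
    where
    split : ∀ {a w} → Edge (i (inj₁ tt)) a w →
            rank w < rank (i (inj₁ tt)) ⊎ (a , w) ∈ init Q (i ∘ inj₂ ∘ inj₁) (i (inj₁ tt))
    split t with edge⁻¹ pl t
    ... | here refl = inj₁ (above pl _)
    ... | there x   = inj₂ x
  placement-loops (iter P Q) pl bound ent (inj₂ (inj₁ y)) =
    placement-loops Q (iterʳ pl) (above (iterʳ pl))
      (λ x → reachable-entry
               (reachable-mono (bound _) (return-reachable P (iterˡ pl) ent))
               (edge pl (there x)))
      y
  placement-loops (iter P Q) pl bound ent (inj₂ (inj₂ x)) =
    placement-loops P (iterˡ pl) (bound ∘ inj₂ ∘ inj₂) ent x

-- Solutions of fragments and normal forms, derived in extensions of `Mil⁻`.

-- The expression that remains to be executed at a vertex, when κ remains at the continuation.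
solution : ∀ {A b} (P : Form A b) → StExp A → Pos P → StExp A
solution (plus P Q)  κ (inj₁ x)        = solution P κ x
solution (plus P Q)  κ (inj₂ y)        = solution Q κ y
solution (seq P t Q) κ (inj₁ y)        = solution Q κ y
solution (seq P t Q) κ (inj₂ (inj₁ _)) = (opt t + expr Q) · κ
solution (seq P t Q) κ (inj₂ (inj₂ x)) = solution P ((opt t + expr Q) · κ) x
solution (iter P Q)  κ (inj₁ _)        = expr Q ⋆ · κ
solution (iter P Q)  κ (inj₂ (inj₁ y)) = solution Q (expr Q ⋆ · κ) y
solution (iter P Q)  κ (inj₂ (inj₂ x)) = solution P (expr Q ⋆ · κ) x

module Derivations {A : Set} (S : ELSystem A) (mil : Mil⁻-Axiom ⊆ Axiom S) where

  setoid : Setoid _ _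
  setoid = record
    { Carrier       = StExp A
    ; _≈_           = λ e f → S ⊢ e ≐ f
    ; isEquivalence = record { refl = ⊢-refl ; sym = ⊢-sym ; trans = ⊢-trans }
    }

  open Setoid setoid public using (_≈_; reflexive)
  open SetoidReasoning setoid

  mil-axiom : ∀ {e f} → Mil⁻-Axiom (e ≐ f) → e ≈ f
  mil-axiom = axiom ∘ mil

  +-cong : ∀ {e e′ f f′} → e ≈ e′ → f ≈ f′ → e + f ≈ e′ + f′
  +-cong p q = ⊢-trans (⊢-cxt (□ +ˡ _) p) (⊢-cxt (_ +ʳ □) q)

  ·-cong : ∀ {e e′ f f′} → e ≈ e′ → f ≈ f′ → e · f ≈ e′ · f′
  ·-cong p q = ⊢-trans (⊢-cxt (□ ·ˡ _) p) (⊢-cxt (_ ·ʳ □) q)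

  ⋆-cong : ∀ {e e′} → e ≈ e′ → e ⋆ ≈ e′ ⋆
  ⋆-cong = ⊢-cxt (□ ⋆ᶜ)

  +-identityˡ : ∀ {e} → 𝟘 + e ≈ e
  +-identityˡ = ⊢-trans (mil-axiom (+-comm _ _)) (mil-axiom (+-neutral _))

  +-interchange : ∀ {e f g h} → (e + f) + (g + h) ≈ (e + g) + (f + h)
  +-interchange {e} {f} {g} {h} = begin
    (e + f) + (g + h) ≈⟨ mil-axiom (+-assoc _ _ _) ⟩
    e + (f + (g + h)) ≈⟨ +-cong ⊢-refl (mil-axiom (+-assoc _ _ _)) ⟨
    e + ((f + g) + h) ≈⟨ +-cong ⊢-refl (+-cong (mil-axiom (+-comm _ _)) ⊢-refl) ⟩
    e + ((g + f) + h) ≈⟨ +-cong ⊢-refl (mil-axiom (+-assoc _ _ _)) ⟩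
    e + (g + (f + h)) ≈⟨ mil-axiom (+-assoc _ _ _) ⟨
    (e + g) + (f + h) ∎

  -- Since `∑` brackets to the left, its head acts as an accumulator; the induction therefore varies
  -- e.
  ∑-∷ : ∀ e es → ∑ (e ∷ es) ≈ e + ∑ es
  ∑-∷ e []       = ⊢-sym (mil-axiom (+-neutral _))
  ∑-∷ e (f ∷ es) = begin
    ∑ ((e + f) ∷ es) ≈⟨ ∑-∷ (e + f) es ⟩
    (e + f) + ∑ es   ≈⟨ mil-axiom (+-assoc _ _ _) ⟩
    e + (f + ∑ es)   ≈⟨ +-cong ⊢-refl (∑-∷ f es) ⟨
    e + ∑ (f ∷ es)   ∎

  ∑-++ : ∀ es fs → ∑ (es ++ fs) ≈ ∑ es + ∑ fs
  ∑-++ []       fs = ⊢-sym +-identityˡ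
  ∑-++ (e ∷ es) fs = begin
    ∑ (e ∷ es ++ fs)    ≈⟨ ∑-∷ e (es ++ fs) ⟩
    e + ∑ (es ++ fs)    ≈⟨ +-cong ⊢-refl (∑-++ es fs) ⟩
    e + (∑ es + ∑ fs)   ≈⟨ mil-axiom (+-assoc _ _ _) ⟨
    (e + ∑ es) + ∑ fs   ≈⟨ +-cong (∑-∷ e es) ⊢-refl ⟨
    ∑ (e ∷ es) + ∑ fs   ∎

  module _ {X : Set} (s : X → StExp A) where

    summand : Label A × X → StExp A
    summand (a , w) = ⟦ a ⟧ · s w

    sum : List (Label A × X) → StExp A
    sum ts = ∑ (map summand ts)

    sum-++ : ∀ ts us → sum (ts ++ us) ≈ sum ts + sum us
    sum-++ ts us = ⊢-trans 
      (reflexive (cong ∑ (map-++ summand ts us))) (∑-++ (map summand ts) (map summand us))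

    sum-exit : ∀ t {k κ} → s k ≡ κ → sum (exit t k) ≈ opt t · κ
    sum-exit true  refl = ⊢-refl
    sum-exit false _    = ⊢-sym (mil-axiom (·-zeroˡ _))

    -- Agreement of s with `solution` is required syntactically: the assignment on the final chart
    -- satisfies it by computation, and so do its restrictions to subexpressions.
    sum-init : ∀ {b} (P : Form A b) {i k κ} → s k ≡ κ → (∀ x → s (i x) ≡ solution P κ x) →
               sum (init P i k) ≈ expr P · κ
    sum-init nil     _    _ = ⊢-sym (mil-axiom (·-zeroˡ _))
    sum-init (act a) refl _ = ⊢-refl
    sum-init (plus P Q) {i} {k} {κ} eq sol = begin
      sum (init P (i ∘ inj₁) k ++ init Q (i ∘ inj₂) k)       ≈⟨ sum-++ (init P _ k) _ ⟩
      sum (init P (i ∘ inj₁) k) + sum (init Q (i ∘ inj₂) k)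
        ≈⟨ +-cong (sum-init P eq (sol ∘ inj₁)) (sum-init Q eq (sol ∘ inj₂)) ⟩
      expr P · κ + expr Q · κ                                ≈⟨ mil-axiom (·-distʳ-+ _ _ _) ⟨
      (expr P + expr Q) · κ                                  ∎
    sum-init (seq P t Q) _ sol =
      ⊢-trans (sum-init P (sol _) (sol ∘ inj₂ ∘ inj₂)) (⊢-sym (mil-axiom (·-assoc _ _ _)))
    sum-init (iter P Q) _ sol =
      ⊢-trans (sum-init P (sol _) (sol ∘ inj₂ ∘ inj₂)) (⊢-sym (mil-axiom (·-assoc _ _ _)))

    sum-exit-init : ∀ {b} t (P : Form A b) {i k l κ μ} → s k ≡ κ → s l ≡ μ →
                    (∀ x → s (i x) ≡ solution P μ x) →
                    sum (exit t k ++ init P i l) ≈ opt t · κ + expr P · μ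
    sum-exit-init t P {k = k} eq eq′ sol =
      ⊢-trans (sum-++ (exit t k) _) (+-cong (sum-exit t eq) (sum-init P eq′ sol))

    sum-steps : ∀ {b} (P : Form A b) {i k κ} → s k ≡ κ → (∀ x → s (i x) ≡ solution P κ x) →
                ∀ x → solution P κ x ≈ sum (steps P i k x)
    sum-steps (plus P Q)  eq sol (inj₁ x) = sum-steps P eq (sol ∘ inj₁) x
    sum-steps (plus P Q)  eq sol (inj₂ y) = sum-steps Q eq (sol ∘ inj₂) y
    sum-steps (seq P t Q) eq sol (inj₁ y) = sum-steps Q eq (sol ∘ inj₁) y
    sum-steps (seq P t Q) eq sol (inj₂ (inj₁ _)) =
      ⊢-trans (mil-axiom (·-distʳ-+ _ _ _)) (⊢-sym (sum-exit-init t Q eq eq (sol ∘ inj₁)))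
    sum-steps (seq P t Q) eq sol (inj₂ (inj₂ x)) = sum-steps P (sol _) (sol ∘ inj₂ ∘ inj₂) x
    sum-steps (iter P Q) {i} {k} {κ} eq sol (inj₁ _) = begin
      expr Q ⋆ · κ                        ≈⟨ ·-cong (mil-axiom (⋆-unfold _)) ⊢-refl ⟩
      (𝟙 + expr Q · expr Q ⋆) · κ         ≈⟨ mil-axiom (·-distʳ-+ _ _ _) ⟩
      𝟙 · κ + (expr Q · expr Q ⋆) · κ     ≈⟨ +-cong ⊢-refl (mil-axiom (·-assoc _ _ _)) ⟩
      𝟙 · κ + expr Q · (expr Q ⋆ · κ)
        ≈⟨ sum-exit-init true Q eq (sol _) (sol ∘ inj₂ ∘ inj₁) ⟨
      sum (steps (iter P Q) i k (inj₁ tt)) ∎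
    sum-steps (iter P Q) eq sol (inj₂ (inj₁ y)) = sum-steps Q (sol _) (sol ∘ inj₂ ∘ inj₁) y
    sum-steps (iter P Q) eq sol (inj₂ (inj₂ x)) = sum-steps P (sol _) (sol ∘ inj₂ ∘ inj₂) x

  -- Every branch of such a P ends in 0, which absorbs x; associativity and right distributivity
  -- carry x there.
  expr-absorb : ∀ {b} (P : Form A b) → b ≡ false → ∀ {x} → expr P · x ≈ expr P
  expr-absorb nil _ = mil-axiom (·-zeroˡ _)
  expr-absorb (plus {false} P Q) eq =
    ⊢-trans (mil-axiom (·-distʳ-+ _ _ _)) (+-cong (expr-absorb P refl) (expr-absorb Q eq))
  expr-absorb (seq P false Q) eq {x} = begin
    (expr P · (𝟘 + expr Q)) · x   ≈⟨ mil-axiom (·-assoc _ _ _) ⟩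
    expr P · ((𝟘 + expr Q) · x)   ≈⟨ ·-cong ⊢-refl (mil-axiom (·-distʳ-+ _ _ _)) ⟩
    expr P · (𝟘 · x + expr Q · x)
      ≈⟨ ·-cong ⊢-refl (+-cong (mil-axiom (·-zeroˡ _)) (expr-absorb Q eq)) ⟩
    expr P · (𝟘 + expr Q)         ∎

  record NormalForm (e : StExp A) : Set where
    field
      terminates : Bool
      {isNormed} : Bool
      rest       : Form A isNormed
      equal      : e ≈ opt terminates + expr rest
      sound      : terminates ≡ true → e ↓
  open NormalForm

  opt-∨ : ∀ s t → opt {A} s + opt t ≈ opt (s ∨ t)
  opt-∨ true  true  = mil-axiom (+-idem _)
  opt-∨ true  false = mil-axiom (+-neutral _)
  opt-∨ false t     = +-identityˡ

  -- Left factors in forms must be normed. An unnormed P absorbs whatever follows, so the product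
  -- collapses to P; `iterForm` treats stars likewise.
  seqForm : ∀ {b c} (P : Form A b) t (Q : Form A c) →
            ∃[ d ] Σ (Form A d) λ R → expr P · (opt t + expr Q) ≈ expr R
  seqForm {true}  P t Q = _ , seq P t Q , ⊢-refl
  seqForm {false} P t Q = _ , P , expr-absorb P refl

  iterForm : ∀ {b} (P : Form A b) → ∃[ d ] Σ (Form A d) λ R → expr P · expr P ⋆ ≈ expr R
  iterForm {true}  P = _ , iter P P , ⊢-refl
  iterForm {false} P = _ , P , expr-absorb P refl

  ⋆-opt : ∀ t (e : StExp A) → (opt t + e) ⋆ ≈ e ⋆
  ⋆-opt true  e = ⊢-sym (mil-axiom (⋆-𝟙+ _))
  ⋆-opt false e = ⋆-cong +-identityˡ

  ∨-sound : ∀ {e f : StExp A} s {t} → (s ≡ true → e ↓) → (t ≡ true → f ↓) → s ∨ t ≡ true → e + f ↓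
  ∨-sound true  p q _  = +↓ˡ (p refl)
  ∨-sound false p q eq = +↓ʳ (q eq)

  normalForm : ∀ e → NormalForm e
  normalForm 𝟘 = record
    { terminates = false ; rest = nil ; equal = ⊢-sym +-identityˡ ; sound = λ () }
  normalForm 𝟙 = record
    { terminates = true ; rest = nil ; equal = ⊢-sym (mil-axiom (+-neutral _)) ; sound = λ _ → 𝟙↓ }
  normalForm (` a) = record
    { terminates = false ; rest = act a ; equal = ⊢-sym +-identityˡ ; sound = λ () }
  normalForm (e + f) = record
    { terminates = terminates E ∨ terminates F
    ; rest       = plus (rest E) (rest F)
    ; equal      = begin
        e + f                                                     ≈⟨ +-cong (equal E) (equal F) ⟩
        (opt s + expr (rest E)) + (opt t + expr (rest F))         ≈⟨ +-interchange ⟩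
        (opt s + opt t) + (expr (rest E) + expr (rest F))         ≈⟨ +-cong (opt-∨ s t) ⊢-refl ⟩
        opt (s ∨ t) + (expr (rest E) + expr (rest F))             ∎
    ; sound      = ∨-sound s (sound E) (sound F)
    }
    where
    E = normalForm e
    F = normalForm f
    s = terminates E
    t = terminates F
  normalForm (e · f) = product (terminates E) (equal E) (sound E)
    where
    E = normalForm e
    F = normalForm f
    P = rest E
    Q = rest F
    t = terminates F
    PQ = seqForm P t Q
    R = proj₁ (proj₂ PQ)
    expand : ∀ s → e ≈ opt s + expr P → e · f ≈ opt s · (opt t + expr Q) + expr R
    expand s eq = begin
      e · f                                                 ≈⟨ ·-cong eq (equal F) ⟩
      (opt s + expr P) · (opt t + expr Q)                   ≈⟨ mil-axiom (·-distʳ-+ _ _ _) ⟩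
      opt s · (opt t + expr Q) + expr P · (opt t + expr Q)
        ≈⟨ +-cong ⊢-refl (proj₂ (proj₂ PQ)) ⟩
      opt s · (opt t + expr Q) + expr R                     ∎
    product : ∀ s → e ≈ opt s + expr P → (s ≡ true → e ↓) → NormalForm (e · f)
    product true eq e↓ = record
      { terminates = t
      -- If e can terminate at once, f may also start directly, which contributes its own
      -- termination and Q.
      ; rest       = plus Q R
      ; equal      = begin
          e · f                                     ≈⟨ expand true eq ⟩
          𝟙 · (opt t + expr Q) + expr R             ≈⟨ +-cong (mil-axiom (·-idˡ _)) ⊢-refl ⟩
          (opt t + expr Q) + expr R                 ≈⟨ mil-axiom (+-assoc _ _ _) ⟩
          opt t + (expr Q + expr R)                 ∎
      ; sound      = λ eq′ → ·↓ (e↓ refl) (sound F eq′)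
      }
    product false eq _ = record
      { terminates = false
      ; rest       = R
      ; equal      = ⊢-trans (expand false eq) (+-cong (mil-axiom (·-zeroˡ _)) ⊢-refl)
      ; sound      = λ ()
      }
  normalForm (e ⋆) = record
    { terminates = true
    ; rest       = proj₁ (proj₂ PP⋆)
    ; equal      = begin
        e ⋆                              ≈⟨ ⋆-cong (equal E) ⟩
        (opt (terminates E) + expr P) ⋆  ≈⟨ ⋆-opt (terminates E) _ ⟩
        expr P ⋆                         ≈⟨ mil-axiom (⋆-unfold _) ⟩
        𝟙 + expr P · expr P ⋆            ≈⟨ +-cong ⊢-refl (proj₂ (proj₂ PP⋆)) ⟩
        𝟙 + expr (proj₁ (proj₂ PP⋆))     ∎
    ; sound      = λ _ → ⋆↓
    }
    where
    E = normalForm e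
    P = rest E
    PP⋆ = iterForm P

-- The chart for the equation `x = F x + (t + G)`.

-- A normed F yields a loop at the head, and `nil` yields no transition back to it. Any other
-- unnormed coefficient is moved into G beforehand.
data NormedOrNil {A : Set} : ∀ {b} → Form A b → Set where
  normed : (F : Form A true) → NormedOrNil F
  nil    : NormedOrNil nil

module FixpointChart {A : Set} {b c} (F : Form A b) (loopForm : NormedOrNil F)
                     (t : Bool) (G : Form A c) where

  -- The order of the summands gives the ranks: the exits of the head, to `final` and G, lie below
  -- it, and the loop body F lies above it.
  X : Set
  X = ⊤ ⊎ (Pos G ⊎ (⊤ ⊎ Pos F))

  pattern final  = inj₁ tt
  pattern tail y = inj₂ (inj₁ y)
  pattern head   = inj₂ (inj₂ (inj₁ tt))
  pattern body x = inj₂ (inj₂ (inj₂ x))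

  inG : Pos G → X
  inG y = tail y

  inF : Pos F → X
  inF x = body x

  finite : Finite X
  finite = ⊤-finite ⊎ᶠ (finitePos G ⊎ᶠ (⊤-finite ⊎ᶠ finitePos F))

  transitions : X → List (Label A × X)
  transitions final    = []
  transitions (tail y) = steps G inG final y
  transitions head     = (exit t final ++ init G inG final) ++ init F inF head
  transitions (body x) = steps F inF head x

  term : X → Bool
  term final = true
  term _     = false

  open RankedChart (proj₂ finite) head transitions term public
  open Placements (proj₂ finite) head transitions term

  private
    F⁺ = ⊤-finite ⊎ᶠ finitePos F
    G⁺ = finitePos G ⊎ᶠ F⁺

  placementG : Placement G inG final
  placementG = record
    { transitions≡ = λ _ → refl
    ; mono         = index-< ∘ inj₂-mono ⊤-finite G⁺ ∘ inj₁-mono (finitePos G) F⁺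
    ; above        = λ y → index-< (inj₁≺inj₂ ⊤-finite G⁺ {y = inj₁ y})
    ; noTerm       = λ _ ()
    }

  placementF : Placement F inF head
  placementF = record
    { transitions≡ = λ _ → refl
    ; mono         = index-< ∘ inj₂-mono ⊤-finite G⁺ ∘ inj₂-mono (finitePos G) F⁺
                             ∘ inj₂-mono ⊤-finite (finitePos F)
    ; above        = λ x → index-< (inj₂-mono ⊤-finite G⁺ (inj₂-mono (finitePos G) F⁺
                             (inj₁≺inj₂ ⊤-finite (finitePos F) {y = x})))
    ; noTerm       = λ _ ()
    }

  exits-descend : ∀ {a w} → (a , w) ∈ exit t final ++ init G inG final → rank w < rank head
  exits-descend x with ∈-++⁻ (exit t final) x
  ... | inj₁ y with refl ← exit-target t y = index-< (inj₁≺inj₂ ⊤-finite G⁺ {y = inj₂ (inj₁ tt)})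
  ... | inj₂ y with init-targets G y
  ...   | inj₁ refl       = index-< (inj₁≺inj₂ ⊤-finite G⁺ {y = inj₂ (inj₁ tt)})
  ...   | inj₂ (z , refl) = index-< (inj₂-mono ⊤-finite G⁺
                            (inj₁≺inj₂ (finitePos G) F⁺ {x = z} {y = inj₁ tt}))

  head-edges : ∀ {a w} → Edge head a w → rank w < rank head ⊎ (a , w) ∈ init F inF head
  head-edges x with ∈-++⁻ (exit t final ++ init G inG final) x
  ... | inj₁ y = inj₁ (exits-descend y)
  ... | inj₂ y = inj₂ y

  head-loop : LoopAt head ⊎ OnlyDescents head
  -- The helper `go` abstracts over F so that matching on `loopForm` can determine its form.
  head-loop = go loopForm placementF head-edges (∈-++⁺ʳ _)
    where
    go : ∀ {b} {F : Form A b} {i} → NormedOrNil F → Placement F i head →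
         (∀ {a w} → Edge head a w → rank w < rank head ⊎ (a , w) ∈ init F i head) →
         (∀ {a w} → (a , w) ∈ init F i head → Edge head a w) →
         LoopAt head ⊎ OnlyDescents head
    go (normed F) pl split into = inj₁ (loopAt pl split into ε)
    go nil        _  split _    = inj₂ λ x → descends (split x)
      where
      descends : ∀ {l} {a : Label A} {w : X} → l ⊎ (a , w) ∈ [] → l
      descends (inj₁ lt) = lt

  loops : ∀ v → LoopAt v ⊎ OnlyDescents v
  loops final    = inj₂ λ ()
  -- The exits of the head are descents, so G is entered without any loop entry and the bound can be
  -- 0. For F the bound is one more than the rank of the head.
  loops (tail y) = placement-loops G placementG (λ _ → z≤n) entered y
    where
    entered : Entered 0 G inG final
    entered x = let x′ = ∈-++⁺ʳ (exit t final) x in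
      (_ , ∈-++⁺ˡ x′ , inj₁ (exits-descend x′)) ◅ ε
  loops head     = head-loop
  loops (body x) = placement-loops F placementF (Placement.above placementF)
                     (reachable-entry ε ∘ ∈-++⁺ʳ _) x

  open Elimination loops public

  assign : StExp A → X → StExp A
  assign x final    = 𝟙
  assign x (tail y) = solution G 𝟙 y
  assign x head     = x
  assign x (body y) = solution F x y

  module _ (S : ELSystem A) (mil : Mil⁻-Axiom ⊆ Axiom S) where
    open Derivations S mil
    open SetoidReasoning setoid

    assign-solves : ∀ {x} → x ≈ expr F · x + (opt t + expr G) →
                    ProvableSolution chart S (assign x)
    assign-solves {x} eq v = transitions v , (λ _ _ → mk⇔ id id) , equation v
      where
      s = assign x
      equation : ∀ v → s v ≈ τ chart v + sum s (transitions v)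
      equation final    = ⊢-sym (mil-axiom (+-neutral _))
      equation (tail y) =
        ⊢-trans (sum-steps s G refl (λ _ → refl) y) (⊢-sym +-identityˡ)
      equation (body y) =
        ⊢-trans (sum-steps s F refl (λ _ → refl) y) (⊢-sym +-identityˡ)
      equation head     = begin
        x                                            ≈⟨ eq ⟩
        expr F · x + (opt t + expr G)                ≈⟨ mil-axiom (+-comm _ _) ⟩
        (opt t + expr G) + expr F · x
          ≈⟨ +-cong (+-cong (mil-axiom (·-idʳ _)) (mil-axiom (·-idʳ _))) ⊢-refl ⟨
        (opt t · 𝟙 + expr G · 𝟙) + expr F · x
          ≈⟨ +-cong (sum-exit-init s t G refl refl (λ _ → refl))
                    (sum-init s F refl (λ _ → refl)) ⟨
        sum s (exit t final ++ init G inG final) + sum s (init F inF head)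
          ≈⟨ sum-++ s (exit t final ++ init G inG final) _ ⟨
        sum s (transitions head)                     ≈⟨ +-identityˡ ⟨
        𝟘 + sum s (transitions head)                 ∎

    fixpoints-equal : ∀ {x y} → x ≈ expr F · x + (opt t + expr G) →
                      y ≈ expr F · y + (opt t + expr G) → S ⊢LLEE (x ≐ y)
    fixpoints-equal {x} {y} eq₁ eq₂ = record
      { chart         = chart
      ; weaklyGuarded = weaklyGuarded
      ; L             = λ v → assign x v ≐ assign y v
      ; solution₁     = assign-solves eq₁
      ; solution₂     = assign-solves eq₂
      ; conclusion    = refl
      } , guardedLLEE

-- Solutions of guarded equations, and iteration as a solution.

module _ {A : Set} (S : ELSystem A) (mil : Mil⁻-Axiom ⊆ Axiom S) where
  open Derivations S mil
  open NormalForm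
  open SetoidReasoning setoid

  -- As f does not terminate immediately, its normal form has constant part 0, so f is provably
  -- equal to a `Form`, and the chart above applies.
  guarded-fixpoints-equal : ∀ {f g x y} → ¬ (f ↓) → x ≈ f · x + g → y ≈ f · y + g →
                            S ⊢LLEE (x ≐ y)
  guarded-fixpoints-equal {f} {g} {x} {y} ¬f↓ eq₁ eq₂ =
    go (rest F) (f≈ (terminates F) (equal F) (sound F))
    where
    F = normalForm f
    G = normalForm g
    t = terminates G

    f≈ : ∀ {e} s → f ≈ opt s + e → (s ≡ true → f ↓) → f ≈ e
    f≈ true  _  f↓ = contradiction (f↓ refl) ¬f↓
    f≈ false eq _  = ⊢-trans eq +-identityˡ

    go : ∀ {b} (P : Form A b) → f ≈ expr P → S ⊢LLEE (x ≐ y)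
    go {true} P f≈P =
      FixpointChart.fixpoints-equal P (normed P) t (rest G) S mil (unfold eq₁) (unfold eq₂)
      where
      unfold : ∀ {x} → x ≈ f · x + g → x ≈ expr P · x + (opt t + expr (rest G))
      unfold eq = ⊢-trans eq (+-cong (·-cong f≈P ⊢-refl) (equal G))
    -- Here P absorbs x, so P x is a constant that joins g, and 0 becomes the coefficient of x.
    go {false} P f≈P =
      FixpointChart.fixpoints-equal nil nil t (plus P (rest G)) S mil (unfold eq₁) (unfold eq₂)
      where
      Q = rest G
      unfold : ∀ {x} → x ≈ f · x + g → x ≈ 𝟘 · x + (opt t + (expr P + expr Q))
      unfold {x} eq = begin
        x                                  ≈⟨ eq ⟩
        f · x + g                          ≈⟨ +-cong (·-cong f≈P ⊢-refl) (equal G) ⟩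
        expr P · x + (opt t + expr Q)      ≈⟨ +-cong (expr-absorb P refl) ⊢-refl ⟩
        expr P + (opt t + expr Q)          ≈⟨ +-cong +-identityˡ ⊢-refl ⟨
        (𝟘 + expr P) + (opt t + expr Q)    ≈⟨ +-interchange ⟩
        (𝟘 + opt t) + (expr P + expr Q)    ≈⟨ mil-axiom (+-assoc _ _ _) ⟩
        𝟘 + (opt t + (expr P + expr Q))    ≈⟨ +-cong (mil-axiom (·-zeroˡ _)) ⊢-refl ⟨
        𝟘 · x + (opt t + (expr P + expr Q)) ∎

  ⋆-fixpoint : ∀ f g → f ⋆ · g ≈ f · (f ⋆ · g) + g
  ⋆-fixpoint f g = begin
    f ⋆ · g                  ≈⟨ ·-cong (mil-axiom (⋆-unfold _)) ⊢-refl ⟩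
    (𝟙 + f · f ⋆) · g        ≈⟨ mil-axiom (·-distʳ-+ _ _ _) ⟩
    𝟙 · g + (f · f ⋆) · g    ≈⟨ +-cong (mil-axiom (·-idˡ _)) (mil-axiom (·-assoc _ _ _)) ⟩
    g + f · (f ⋆ · g)        ≈⟨ mil-axiom (+-comm _ _) ⟩
    f · (f ⋆ · g) + g        ∎

lemma7p3 : (A : Set) (e f g : StExp A) → ¬ (f ↓) →
    (Mil⁻ ⊕ ｛ e ≐ f · e + g ｝) ⊢LLEE (e ≐ f ⋆ · g)
lemma7p3 A e f g ¬f↓ =
  -- The added axiom says that e is a solution; for the iteration this follows by unfolding the
  -- star.
  guarded-fixpoints-equal S inj₁ ¬f↓ (axiom (inj₂ refl)) (⋆-fixpoint S inj₁ f g)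
  where
  S : ELSystem A
  S = Mil⁻ ⊕ ｛ e ≐ f · e + g ｝
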